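{- Let $n\in\{2,3\}$. For every perfect matching $M$ of the folded hypercube $FQ_n$, the graph $FQ_n-M$ (obtained from $FQ_n$ by deleting the edges of $M$) is isomorphic to the hypercube $Q_n$.
   Context: The $n$-dimensional hypercube $Q_n$ has vertex set $\{0,1\}^n$ (binary strings $x_1x_2\cdots x_n$), two vertices being adjacent iff they differ in exactly one position. The $n$-dimensional folded hypercube $FQ_n$ is obtained from $Q_n$ by adding the $2^{n-1}$ complementary edges joining each $x_1x_2\cdots x_n$ to $\overline{x}_1\overline{x}_2\cdots\overline{x}_n$, where $\overline{x}_i=1-x_i$. A perfect matching of a graph $G$ is a set of pairwise vertex-disjoint edges covering every vertex, i.e. a matching of size $|V(G)|/2$. -}

module Defs where

open import Data.Nat using (ℕ)
open import Data.Bool using (Bool; not)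
open import Data.Vec using (Vec; map)
open import Data.Fin using (Fin)
open import Data.Product using (_×_; Σ; ∃; ∃!)
open import Data.Sum using (_⊎_)
open import Level using (0ℓ)
open import Relation.Nullary using (¬_)
open import Relation.Binary.PropositionalEquality using (_≡_; _≢_)
open import Function.Bundles using (_⤖_; Bijection)

Vertex : ℕ → Set
Vertex n = Vec Bool n

Graph : Set → Set₁
Graph V = V → V → Set

DifferInExactlyOne : {n : ℕ} → Vertex n → Vertex n → Set
DifferInExactlyOne {n} x y =
  Σ (Fin n) λ i → (Data.Vec.lookup x i ≢ Data.Vec.lookup y i)
    × (∀ j → j ≢ i → Data.Vec.lookup x j ≡ Data.Vec.lookup y j)

Q : (n : ℕ) → Graph (Vertex n)
Q n x y = DifferInExactlyOne x y

complement : {n : ℕ} → Vertex n → Vertex n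
complement = map not

FQ : (n : ℕ) → Graph (Vertex n)
FQ n x y = Q n x y ⊎ (y ≡ complement x)

record PerfectMatching {V : Set} (G : Graph V) : Set₁ where
  field
    edge      : V → V → Set
    symmetric : ∀ {x y} → edge x y → edge y x
    ⊆G        : ∀ {x y} → edge x y → G x y
    unique    : ∀ x → ∃! _≡_ (λ y → edge x y)

_∖_ : {V : Set} (G : Graph V) → PerfectMatching G → Graph V
(G ∖ M) x y = G x y × ¬ PerfectMatching.edge M x y

record _≅_ {V W : Set} (G : Graph V) (H : Graph W) : Set where
  field
    bij      : V ⤖ W
    preserve : ∀ x y → G x y → H (Bijection.to bij x) (Bijection.to bij y)
    reflect  : ∀ x y → H (Bijection.to bij x) (Bijection.to bij y) → G x y

{-# OPTIONS --safe #-}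
-- Suppose a 2-colouring c has the property that both the mate map m of M and
-- complementation reverse colours. Fixing one colour class and sending x to
-- complement (m x) on the other gives a bijection φ with φ ∘ m = complement ∘ φ.
-- If moreover φ is an automorphism of FQ n, it carries M to the complementary
-- edges, hence FQ n ∖ M to Q n.
--
-- FQ 3 is K₄,₄, with parity as the colouring, and φ is an automorphism because it
-- preserves parity. FQ 2 is K₄, where every bijection is an automorphism; the
-- colouring is a coordinate in which 00 and its mate differ.
module Submission where

open import Defs
open import Data.Nat using (ℕ)
open import Data.Sum using (_⊎_)
open import Relation.Binary.PropositionalEquality using (_≡_)

open import Data.Bool using (Bool; true; false; not; if_then_else_; _xor_)
open import Data.Bool.Properties using (not-involutive; not-¬; ¬-not)
  renaming (_≟_ to _≟ᵇ_)
open import Data.Empty using (⊥-elim)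
open import Data.Fin using (Fin; zero; suc)
open import Data.Fin.Properties using (any?; all?) renaming (_≟_ to _≟ᶠ_)
open import Data.Nat using (zero; suc; _+_)
open import Data.Product using (∃; _,_; proj₁; proj₂)
open import Data.Sum using (inj₁; inj₂)
open import Data.Vec using ([]; _∷_; foldr′; lookup; replicate)
open import Data.Vec.Properties using (≡-dec; lookup-map; map-cong; map-id; map-∘)
open import Function using (_∘_)
open import Function.Bundles using (_⤖_; _⇔_; Bijection; Equivalence; mk↔ₛ′; mk⇔)
open import Function.Construct.Composition using (_⇔-∘_)
open import Function.Construct.Symmetry using (⇔-sym)
open import Function.Properties.Inverse using (↔⇒⤖)
open import Relation.Binary.PropositionalEquality
  using (_≢_; refl; sym; trans; cong; subst; ≢-sym)
open import Relation.Nullary using (¬_; Dec)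
open import Relation.Nullary.Decidable
  using (¬?; _×-dec_; _⊎-dec_; _→-dec_; map′; from-yes)

module ColourReversingInvolutions {A : Set} (c : A → Bool) where

  Involutive Reverses : (A → A) → Set
  Involutive f = ∀ x → f (f x) ≡ x
  Reverses f = ∀ x → c (f x) ≡ not (c x)

  conjugator : (f g : A → A) → A → A
  conjugator f g x = if c x then g (f x) else x

  module _ (f g : A → A) (f-rev : Reverses f) (g-rev : Reverses g) where

    reverses-twice : ∀ x → c (g (f x)) ≡ c x
    reverses-twice x =
      trans (g-rev (f x)) (trans (cong not (f-rev x)) (not-involutive (c x)))

    -- On one class nothing moves; on the other the two reversals cancel. When adjacency means
    -- having different colours, this makes the conjugator an automorphism.
    conjugator-colour : ∀ x → c (conjugator f g x) ≡ c x
    conjugator-colour x with c x in eq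
    ... | true  = trans (reverses-twice x) eq
    ... | false = eq

    -- An element moved to `g (f x)` keeps its colour, so the swapped conjugator applies `f ∘ g` to
    -- it and undoes the move.
    conjugator-inverse : Involutive f → Involutive g →
      ∀ x → conjugator g f (conjugator f g x) ≡ x
    conjugator-inverse f-inv g-inv x with c x in eq
    ... | false rewrite eq = refl
    ... | true rewrite reverses-twice x | eq = trans (cong f (g-inv (f x))) (f-inv x)

    conjugator-intertwines : Involutive f → Involutive g →
      ∀ x → conjugator f g (f x) ≡ g (conjugator f g x)
    -- Exactly one of `x` and `f x` is moved. Replacing `c (f x)` by `not (c x)` lets a single case
    -- split settle both conditionals.
    conjugator-intertwines f-inv g-inv x rewrite f-rev x with c x
    ... | true  = sym (g-inv (f x))
    ... | false = cong g (f-inv x)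

  conjugator-⤖ : ∀ f g → Reverses f → Reverses g → Involutive f → Involutive g → A ⤖ A
  conjugator-⤖ f g f-rev g-rev f-inv g-inv = ↔⇒⤖ (mk↔ₛ′ (conjugator f g) (conjugator g f)
    (conjugator-inverse g f g-rev f-rev g-inv f-inv)
    (conjugator-inverse f g f-rev g-rev f-inv g-inv))

module _ {V : Set} {G : Graph V} (M : PerfectMatching G) where
  open PerfectMatching M

  mate : V → V
  mate x = proj₁ (unique x)

  mate-edge : ∀ x → edge x (mate x)
  mate-edge x = proj₁ (proj₂ (unique x))

  mate-unique : ∀ {x y} → edge x y → mate x ≡ y
  mate-unique {x} = proj₂ (proj₂ (unique x))

  mate-involutive : ∀ x → mate (mate x) ≡ x
  mate-involutive x = mate-unique (symmetric (mate-edge x))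

complement-involutive : ∀ {n} (x : Vertex n) → complement (complement x) ≡ x
complement-involutive x =
  trans (sym (map-∘ not not x)) (trans (map-cong not-involutive x) (map-id x))

-- Two coordinates leave some position besides `i`, where adjacency demands agreement but
-- complementation forces a difference. In `Q 1` complements are adjacent, hence `2 + n`.
complement-not-Q-adjacent : ∀ {n} (x : Vertex (2 + n)) → ¬ Q (2 + n) x (complement x)
complement-not-Q-adjacent x (i , _ , agree) = not-¬ refl
  (trans (agree j (proj₂ (other i))) (lookup-map j not x))
  where
  other : ∀ {n} (i : Fin (2 + n)) → ∃ λ j → j ≢ i
  other zero    = suc zero , λ ()
  other (suc i) = zero , λ ()
  j = proj₁ (other i)

module _ {n : ℕ} (M : PerfectMatching (FQ (2 + n))) (c : Vertex (2 + n) → Bool) where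
  open ColourReversingInvolutions c
  open PerfectMatching M

  ∖-≅-Q : Reverses (mate M) → Reverses complement →
    (let φ = conjugator (mate M) complement) →
    (∀ x y → FQ (2 + n) x y ⇔ FQ (2 + n) (φ x) (φ y)) →
    (FQ (2 + n) ∖ M) ≅ Q (2 + n)
  ∖-≅-Q m-rev c-rev automorphism = record
    { bij      = φ⤖
    ; preserve = λ x y (adj , ¬e) →
        preserve′ x y ¬e (Equivalence.to (automorphism x y) adj)
    ; reflect  = λ x y adj →
        Equivalence.from (automorphism x y) (inj₁ adj) , λ e →
        -- A matching edge from `x` to `y` would make `φ y` the complement of `φ x`.
        complement-not-Q-adjacent (φ x)
          (subst (Q _ (φ x)) (trans (cong φ (sym (mate-unique M e))) (intertwines x)) adj)
    }
    where
    φ = conjugator (mate M) complement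

    φ⤖ : Vertex (2 + n) ⤖ Vertex (2 + n)
    φ⤖ =
      conjugator-⤖ (mate M) complement m-rev c-rev (mate-involutive M) complement-involutive

    intertwines : ∀ x → φ (mate M x) ≡ complement (φ x)
    intertwines =
      conjugator-intertwines (mate M) complement m-rev c-rev (mate-involutive M) complement-involutive

    preserve′ : ∀ x y → ¬ edge x y → FQ _ (φ x) (φ y) → Q _ (φ x) (φ y)
    preserve′ x y ¬e (inj₁ adj) = adj
    -- If the images are complementary, then `φ y` equals `φ (mate M x)`, and injectivity makes `y`
    -- the mate of `x`.
    preserve′ x y ¬e (inj₂ eq)  = ⊥-elim (¬e (subst (edge x) mate≡y (mate-edge M x)))
      where
      mate≡y : mate M x ≡ y
      mate≡y = Bijection.injective φ⤖ (trans (intertwines x) (sym eq))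

_≟ᵛ_ : ∀ {n} (x y : Vertex n) → Dec (x ≡ y)
_≟ᵛ_ = ≡-dec _≟ᵇ_

-- Enumerates the cube, so that the concrete facts about `FQ 2` and `FQ 3` are settled by
-- evaluation.
∀Vertex? : ∀ {n} {P : Vertex n → Set} → (∀ x → Dec (P x)) → Dec (∀ x → P x)
∀Vertex? {zero}  P? = map′ (λ { p [] → p }) (λ p → p []) (P? [])
∀Vertex? {suc n} P? = map′
  (λ { (f , t) (false ∷ x) → f x ; (f , t) (true ∷ x) → t x })
  (λ p → (λ x → p (false ∷ x)) , (λ x → p (true ∷ x)))
  (∀Vertex? (P? ∘ (false ∷_)) ×-dec ∀Vertex? (P? ∘ (true ∷_)))

FQ? : ∀ n (x y : Vertex n) → Dec (FQ n x y)
FQ? n x y = any? (λ i → ¬? (lookup x i ≟ᵇ lookup y i) ×-dec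
    all? (λ j → ¬? (j ≟ᶠ i) →-dec (lookup x j ≟ᵇ lookup y j)))
  ⊎-dec (y ≟ᵛ complement x)

_⇔?_ : ∀ {A B : Set} → Dec A → Dec B → Dec (A ⇔ B)
a? ⇔? b? = map′ (λ (f , g) → mk⇔ f g) (λ e → Equivalence.to e , Equivalence.from e)
  ((a? →-dec b?) ×-dec (b? →-dec a?))

-- Distinct strings of length 2 differ in one position or in both, and in the latter case they are
-- complementary.
FQ₂-complete : ∀ x y → FQ 2 x y ⇔ x ≢ y
FQ₂-complete = from-yes
  (∀Vertex? λ x → ∀Vertex? λ y → FQ? 2 x y ⇔? ¬? (x ≟ᵛ y))

parity : ∀ {n} → Vertex n → Bool
parity = foldr′ _xor_ false

-- Edges flip one or three bits, and strings of length 3 have different parities exactly when they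
-- differ in one or three positions.
FQ₃-complete-bipartite : ∀ x y → FQ 3 x y ⇔ parity x ≢ parity y
FQ₃-complete-bipartite = from-yes
  (∀Vertex? λ x → ∀Vertex? λ y → FQ? 3 x y ⇔? ¬? (parity x ≟ᵇ parity y))

≢-cong-⇔ : ∀ {A B : Set} {a b : A} {a′ b′ : B} →
  (a ≡ b → a′ ≡ b′) → (a′ ≡ b′ → a ≡ b) → (a ≢ b) ⇔ (a′ ≢ b′)
≢-cong-⇔ f g = mk⇔ (_∘ g) (_∘ f)

origin : Vertex 2
origin = replicate 2 false

nonzero-coordinate : ∀ z → origin ≢ z → ∃ λ i → lookup z i ≡ true
nonzero-coordinate = from-yes
  (∀Vertex? λ z → ¬? (origin ≟ᵛ z) →-dec any? (λ i → lookup z i ≟ᵇ true))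

-- The hypotheses say that {x , y} is either equal to or disjoint from {origin , z}.
coordinate-separates : ∀ z i x y → lookup z i ≡ true → x ≢ y →
  (x ≡ origin → y ≡ z) → (x ≡ z → y ≡ origin) →
  (y ≡ origin → x ≡ z) → (y ≡ z → x ≡ origin) →
  lookup y i ≡ not (lookup x i)
coordinate-separates = from-yes
  (∀Vertex? λ z → all? λ i → ∀Vertex? λ x → ∀Vertex? λ y →
    (lookup z i ≟ᵇ true) →-dec ¬? (x ≟ᵛ y) →-dec
    ((x ≟ᵛ origin) →-dec (y ≟ᵛ z)) →-dec ((x ≟ᵛ z) →-dec (y ≟ᵛ origin)) →-dec
    ((y ≟ᵛ origin) →-dec (x ≟ᵛ z)) →-dec ((y ≟ᵛ z) →-dec (x ≟ᵛ origin)) →-dec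
    (lookup y i ≟ᵇ not (lookup x i)))

FQ₂∖M≅Q₂ : (M : PerfectMatching (FQ 2)) → (FQ 2 ∖ M) ≅ Q 2
FQ₂∖M≅Q₂ M = ∖-≅-Q M c m-rev c-rev λ x y →
  ⇔-sym (FQ₂-complete _ _) ⇔-∘
  (≢-cong-⇔ (cong (Bijection.to φ⤖)) (Bijection.injective φ⤖) ⇔-∘ FQ₂-complete x y)
  where
  m = mate M

  m-inv : ∀ x → m (m x) ≡ x
  m-inv = mate-involutive M

  x≢mx : ∀ x → x ≢ m x
  x≢mx x = Equivalence.to (FQ₂-complete x (m x)) (PerfectMatching.⊆G M (mate-edge M x))

  separating : ∃ λ i → lookup (m origin) i ≡ true
  separating = nonzero-coordinate (m origin) (x≢mx origin)

  c : Vertex 2 → Bool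
  c x = lookup x (proj₁ separating)

  open ColourReversingInvolutions c

  -- The involution `m` swaps `origin` and `m origin`, which `c` separates. Each colour occurs twice
  -- among the four vertices, so `c` also separates the other matched pair.
  m-rev : Reverses m
  m-rev x = coordinate-separates (m origin) (proj₁ separating) x (m x)
    (proj₂ separating) (x≢mx x)
    (cong m) (λ eq → trans (cong m eq) (m-inv origin))
    (λ eq → trans (sym (m-inv x)) (cong m eq))
    (λ eq → trans (sym (m-inv x)) (trans (cong m eq) (m-inv origin)))

  c-rev : Reverses complement
  c-rev x = lookup-map (proj₁ separating) not x

  φ⤖ : Vertex 2 ⤖ Vertex 2
  φ⤖ = conjugator-⤖ m complement m-rev c-rev m-inv complement-involutive

FQ₃∖M≅Q₃ : (M : PerfectMatching (FQ 3)) → (FQ 3 ∖ M) ≅ Q 3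
FQ₃∖M≅Q₃ M = ∖-≅-Q M parity m-rev c-rev λ x y →
  ⇔-sym (FQ₃-complete-bipartite _ _) ⇔-∘ (≢-cong-⇔
    (λ eq → trans (colour x) (trans eq (sym (colour y))))
    (λ eq → trans (sym (colour x)) (trans eq (colour y)))
  ⇔-∘ FQ₃-complete-bipartite x y)
  where
  open ColourReversingInvolutions (parity {3})

  -- Serves both reversal hypotheses, since mates and complements are alike neighbours in `FQ 3`.
  neighbour-parity : ∀ {x y} → FQ 3 x y → parity y ≡ not (parity x)
  neighbour-parity adj = ¬-not (≢-sym (Equivalence.to (FQ₃-complete-bipartite _ _) adj))

  m-rev : Reverses (mate M)
  m-rev x = neighbour-parity (PerfectMatching.⊆G M (mate-edge M x))

  c-rev : Reverses complement
  c-rev x = neighbour-parity {x} (inj₂ refl)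

  colour : ∀ x → parity (conjugator (mate M) complement x) ≡ parity x
  colour = conjugator-colour (mate M) complement m-rev c-rev

theorem2p1 : (n : ℕ) → (n ≡ 2 ⊎ n ≡ 3) →
    (M : PerfectMatching (FQ n)) → (FQ n ∖ M) ≅ Q n
theorem2p1 _ (inj₁ refl) = FQ₂∖M≅Q₂
theorem2p1 _ (inj₂ refl) = FQ₃∖M≅Q₃
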